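{- Let $(\mathcal{A},\mathbf{m})$ be a cyclic sequencing problem with $n$ symbols, and consider the associated mixed integer quadratic program (MIQP) given in the context. A valid lower bound on the optimal solution cost of the MIQP is $$LB=\sum_{k=1}^n LB_k,$$ where, for each $k\in\{1,\ldots,n\}$, $$LB_k:=\min\Big\{\sum_{i\in\hat{\mathcal{J}}_k}\Delta_i^2\;:\;\sum_{i\in\hat{\mathcal{J}}_k}\Delta_i=N,\ \Delta_i\in\mathbb{R},\ \Delta_i\ge 0\ \ \forall i\in\hat{\mathcal{J}}_k\Big\},$$ and the optimal distances in the problem defining $LB_k$ are $$\Delta_i=\frac{N}{m_k},\qquad\forall i\in\hat{\mathcal{J}}_k.$$
   Context: Here $\mathbb{N}=\{1,2,\ldots\}$. A cyclic sequencing problem is a couple $(\mathcal{A},\mathbf{m})$, where $\mathcal{A}=[a_1,\ldots,a_n]$ is an alphabet of $n$ distinct symbols and $\mathbf{m}=(m_1,\ldots,m_n)\in\mathbb{N}^n$ is the vector of prescribed multiplicities. Put $N:=\sum_{k=1}^n m_k$, $\hat{\mathcal{J}}:=\{1,\ldots,N\}$, $\hat m_k:=\sum_{h=1}^k m_h$, $\check m_1:=1$, $\check m_k:=\hat m_{k-1}+1$ for $k\ge 2$, and $\hat{\mathcal{J}}_k:=\{\check m_k,\check m_k+1,\ldots,\hat m_k\}$, so that $|\hat{\mathcal{J}}_k|=m_k$ and the sets $\hat{\mathcal{J}}_k$ partition $\hat{\mathcal{J}}$. The MIQP has variables $x_{ij}$ ($i,j\in\hat{\mathcal{J}}$, $i\ne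 j$) and real variables $\theta_i,\Delta_i$ ($i\in\hat{\mathcal{J}}$), and reads: minimize $\sum_{i\in\hat{\mathcal{J}}}\Delta_i^2$ subject to (1) $\sum_{j\in\hat{\mathcal{J}},\,j\neq i}x_{ij}=1$ for all $i\in\hat{\mathcal{J}}$; (2) $\sum_{i\in\hat{\mathcal{J}},\,i\neq j}x_{ij}=1$ for all $j\in\hat{\mathcal{J}}$; (3) $\theta_i-\theta_j+Nx_{ij}\le N-1$ for all $i,j\in\hat{\mathcal{J}}\setminus\{1\}$, $i\ne j$; (4) $\theta_i\le\theta_{i+1}$ for all $i\in\hat{\mathcal{J}}_k\setminus\{\hat m_k\}$, $k\in\{1,\ldots,n\}$; (5) $\Delta_i=\theta_{i+1}-\theta_i$ for all $i\in\hat{\mathcal{J}}_k\setminus\{\hat m_k\}$, $k\in\{1,\ldots,n\}$; (6) $\Delta_{\hat m_k}=N-\theta_{\hat m_k}+\theta_{\check m_k}$ for all $k\in\{1,\ldots,n\}$; (7) $x_{ij}\in\{0,1\}$, $\theta_i\ge 0$, $\Delta_i\ge 0$ for all indices. A valid lower bound is a number not exceeding the objective value of any feasible solution of the MIQP. -}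

module Defs where

open import Level using (Level; _⊔_) renaming (suc to lsuc)
open import Algebra.Apartness.Bundles using (HeytingCommutativeRing; HeytingField)
open import Algebra.Bundles using (CommutativeRing)
open import Data.Fin.Base using (Fin; zero; suc; inject₁)
open import Data.List.Base using (List; []; _∷_; map; foldr; filter; applyUpTo; allFin)
open import Data.List.Membership.Propositional using (_∈_)
open import Data.Nat.Base as ℕ using (ℕ; zero; suc; NonZero)
import Data.Nat.Properties as ℕ
open import Data.Product.Base using (∃; ∃-syntax; _×_; _,_; proj₁; proj₂)
open import Data.Sum.Base using (_⊎_; inj₁; inj₂)
open import Function.Definitions using (Injective)
open import Relation.Binary.Core using (Rel)
open import Relation.Binary.Structures using (IsStrictPartialOrder)
open import Relation.Binary.PropositionalEquality.Core using (_≡_; _≢_)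
open import Relation.Nullary using (¬_; ¬?)
import Algebra.Apartness.Properties.HeytingCommutativeRing as HeytingProperties
import Algebra.Definitions.RawMonoid as RawMonoidDefinitions
import Algebra.Properties.Ring as RingProperties

-- The real numbers, axiomatised constructively as a Cauchy-complete
-- Archimedean ordered field.  Classically ℝ is the only model up to
-- isomorphism; Bishop's regular sequences of rationals, as a setoid, are
-- a model without any choice or excluded middle.

record RealField (c ℓ₁ ℓ₂ ℓ₃ : Level) : Set (lsuc (c ⊔ ℓ₁ ⊔ ℓ₂ ⊔ ℓ₃)) where
  infix 4 _<_ _≤_
  field
    heytingField : HeytingField c ℓ₁ ℓ₂

  open HeytingField heytingField public

  field
    _<_                  : Rel Carrier ℓ₃
    isStrictPartialOrder : IsStrictPartialOrder _≈_ _<_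
    #⇒<⊎>                : ∀ {x y} → x # y → x < y ⊎ y < x
    <⇒#                  : ∀ {x y} → x < y → x # y
    +-monoˡ-<            : ∀ {x y} z → x < y → x + z < y + z
    *-pos                : ∀ {x y} → 0# < x → 0# < y → 0# < x * y

  open HeytingCommutativeRing heytingCommutativeRing public using (commutativeRing)
  open CommutativeRing commutativeRing public using (ring; +-rawMonoid)
  open RawMonoidDefinitions +-rawMonoid
    using () renaming (_×_ to _·_)

  fromℕ : ℕ → Carrier
  fromℕ n = n · 1#

  -- The non-strict order is negative, as usual constructively: a primitive
  -- disjunction x < y ⊎ x ≈ y would be strictly stronger.
  _≤_ : Rel Carrier ℓ₃
  x ≤ y = ¬ (y < x)

  -- ∣ x - y ∣ < ε
  Within : Carrier → Carrier → Carrier → Set ℓ₃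
  Within ε x y = (x < y + ε) × (y < x + ε)

  IsCauchy : (ℕ → Carrier) → Set (c ⊔ ℓ₃)
  IsCauchy s = ∀ ε → 0# < ε →
    ∃[ M ] (∀ p q → M ℕ.≤ p → M ℕ.≤ q → Within ε (s p) (s q))

  _ConvergesTo_ : (ℕ → Carrier) → Carrier → Set (c ⊔ ℓ₃)
  s ConvergesTo l = ∀ ε → 0# < ε →
    ∃[ M ] (∀ p → M ℕ.≤ p → Within ε (s p) l)

  field
    archimedean : ∀ x → ∃[ n ] (x < fromℕ n)
    complete    : ∀ s → IsCauchy s → ∃[ l ] (s ConvergesTo l)

  module < = IsStrictPartialOrder isStrictPartialOrder

  open HeytingProperties heytingCommutativeRing using (1#0)
  open RingProperties ring using (-‿distribˡ-*; -‿involutive)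

  0<1 : 0# < 1#
  0<1 with #⇒<⊎> 1#0
  ... | inj₂ p = p
  ... | inj₁ p = <.<-respʳ-≈ square (*-pos 0<-1 0<-1)
    where
    0<-1 : 0# < - 1#
    0<-1 = <.<-respˡ-≈ (-‿inverseʳ 1#)
             (<.<-respʳ-≈ (+-identityˡ (- 1#)) (+-monoˡ-< (- 1#) p))
    square : - 1# * - 1# ≈ 1#
    square = trans (sym (-‿distribˡ-* 1# (- 1#)))
               (trans (-‿cong (*-identityˡ (- 1#))) (-‿involutive 1#))

  0<fromℕ : ∀ n .{{_ : NonZero n}} → 0# < fromℕ n
  0<fromℕ (suc zero)    = <.<-respʳ-≈ (sym (+-identityʳ 1#)) 0<1
  0<fromℕ (suc (suc n)) = <.trans 0<1
    (<.<-respˡ-≈ (+-identityˡ 1#)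
      (<.<-respʳ-≈ (+-comm (fromℕ (suc n)) 1#) (+-monoˡ-< 1# (0<fromℕ (suc n)))))

  infixl 7 _/_
  _/_ : Carrier → (n : ℕ) .{{_ : NonZero n}} → Carrier
  x / n = x * proj₁ (#⇒invertible (#-sym (<⇒# (0<fromℕ n))))

  sumOver : ∀ {i} {I : Set i} → List I → (I → Carrier) → Carrier
  sumOver xs f = foldr _+_ 0# (map f xs)

  infix 3 sumOver
  syntax sumOver xs (λ i → e) = ∑[ i ∈ xs ] e

  infixl 9 _²
  _² : Carrier → Carrier
  x ² = x * x

  module _ {a p} {A : Set a} (S : A → Set p) (f : A → Carrier) where

    IsMinimiser : A → Set (a ⊔ p ⊔ ℓ₃)
    IsMinimiser x = S x × (∀ y → S y → f x ≤ f y)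

    IsMinimum : Carrier → Set (a ⊔ p ⊔ ℓ₁ ⊔ ℓ₃)
    IsMinimum v = ∃[ x ] (IsMinimiser x × f x ≈ v)

-- {lo, lo + 1, …, hi}, in increasing order and without repetition.
range : ℕ → ℕ → List ℕ
range lo hi = applyUpTo (lo ℕ.+_) (suc hi ℕ.∸ lo)

infixl 6 _∖_
_∖_ : List ℕ → ℕ → List ℕ
xs ∖ i = filter (λ j → ¬? (j ℕ.≟ i)) xs

total : ∀ {n} → (Fin n → ℕ) → ℕ
total {zero}  m = 0
total {suc n} m = m zero ℕ.+ total (λ k → m (suc k))

-- m₁ + ⋯ + mₖ, the k-th term included.
partialSum : ∀ {n} → (Fin n → ℕ) → Fin n → ℕ
partialSum m zero    = m zero
partialSum m (suc k) = m zero ℕ.+ partialSum (λ h → m (suc h)) k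

firstIndex : ∀ {n} → (Fin n → ℕ) → Fin n → ℕ
firstIndex m zero    = 1
firstIndex m (suc k) = partialSum m (inject₁ k) ℕ.+ 1

record CyclicSequencingProblem (a : Level) : Set (lsuc a) where
  field
    n               : ℕ
    {{n-nonZero}}   : NonZero n
    Symbol          : Set a
    alphabet        : Fin n → Symbol
    distinct        : Injective _≡_ _≡_ alphabet
    m               : Fin n → ℕ
    {{m-nonZero}}   : ∀ {k} → NonZero (m k)

  N : ℕ
  N = total m

  m̂ m̌ : Fin n → ℕ
  m̂ = partialSum m
  m̌ = firstIndex m

  Ĵ : List ℕ
  Ĵ = range 1 N

  Ĵ[_] : Fin n → List ℕ
  Ĵ[ k ] = range (m̌ k) (m̂ k)

-- Families indexed by Ĵ are functions on ℕ of which only the values at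
-- indices in Ĵ are ever constrained or summed; likewise the diagonal of x.
module MIQP {c ℓ₁ ℓ₂ ℓ₃ a} (ℝ : RealField c ℓ₁ ℓ₂ ℓ₃) (P : CyclicSequencingProblem a) where
  open RealField ℝ
  open CyclicSequencingProblem P

  record Assignment : Set c where
    field
      x : ℕ → ℕ → Carrier
      θ : ℕ → Carrier
      Δ : ℕ → Carrier

  record Feasible (s : Assignment) : Set (ℓ₁ ⊔ ℓ₃) where
    open Assignment s
    field
      successor   : ∀ {i} → i ∈ Ĵ → (∑[ j ∈ Ĵ ∖ i ] x i j) ≈ 1#
      predecessor : ∀ {j} → j ∈ Ĵ → (∑[ i ∈ Ĵ ∖ j ] x i j) ≈ 1#
      subtour     : ∀ {i j} → i ∈ Ĵ → j ∈ Ĵ → i ≢ 1 → j ≢ 1 → i ≢ j →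
                    θ i - θ j + fromℕ N * x i j ≤ fromℕ N - 1#
      ordered     : ∀ k {i} → i ∈ Ĵ[ k ] → i ≢ m̂ k → θ i ≤ θ (suc i)
      distance    : ∀ k {i} → i ∈ Ĵ[ k ] → i ≢ m̂ k → Δ i ≈ θ (suc i) - θ i
      wraparound  : ∀ k → Δ (m̂ k) ≈ fromℕ N - θ (m̂ k) + θ (m̌ k)
      x-binary    : ∀ {i j} → i ∈ Ĵ → j ∈ Ĵ → i ≢ j → x i j ≈ 0# ⊎ x i j ≈ 1#
      θ-nonNeg    : ∀ {i} → i ∈ Ĵ → 0# ≤ θ i
      Δ-nonNeg    : ∀ {i} → i ∈ Ĵ → 0# ≤ Δ i

  cost : Assignment → Carrier
  cost s = ∑[ i ∈ Ĵ ] (Assignment.Δ s i ²)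

  IsValidLowerBound : Carrier → Set (c ⊔ ℓ₁ ⊔ ℓ₃)
  IsValidLowerBound b = ∀ s → Feasible s → b ≤ cost s

  FeasibleFor : Fin n → (ℕ → Carrier) → Set (ℓ₁ ⊔ ℓ₃)
  FeasibleFor k Δ = (∑[ i ∈ Ĵ[ k ] ] Δ i) ≈ fromℕ N × (∀ {i} → i ∈ Ĵ[ k ] → 0# ≤ Δ i)

  costFor : Fin n → (ℕ → Carrier) → Carrier
  costFor k Δ = ∑[ i ∈ Ĵ[ k ] ] (Δ i ²)

  IsOptimalFor : Fin n → (ℕ → Carrier) → Set (c ⊔ ℓ₁ ⊔ ℓ₃)
  IsOptimalFor k = IsMinimiser (FeasibleFor k) (costFor k)

  -- v is the number LBₖ.
  IsLB : Fin n → Carrier → Set (c ⊔ ℓ₁ ⊔ ℓ₃)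
  IsLB k = IsMinimum (FeasibleFor k) (costFor k)

{-# OPTIONS --safe #-}
module Submission where

-- Writing d = Δ − μ with μ = N/mₖ, every Δ of total N satisfies
-- ∑ Δ² = ∑ μ² + ∑ d², since the mixed term 2μ ∑ d vanishes.  Hence the constant
-- family is optimal, and an optimal Δ has ∑ d² ≤ 0, so that d = 0.  For the lower
-- bound, (5) and (6) telescope around each symbol's cycle to ∑_{Ĵₖ} Δ = N, so a
-- feasible solution of the MIQP restricts to a feasible point of every LBₖ problem,
-- and its cost is the sum of the restricted costs because the Ĵₖ partition Ĵ.

open import Defs
open import Level using (Level)
open import Algebra.Bundles using (CommutativeRing)
open import Data.Fin.Base using (Fin; zero; suc; inject₁)
open import Data.List.Base using (List; []; _∷_; _++_; map; length; allFin; applyUpTo; upTo; concatMap)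
open import Data.List.Membership.Propositional using (_∈_)
open import Data.List.Membership.Propositional.Properties using (∈-applyUpTo⁺; ∈-applyUpTo⁻)
open import Data.List.Properties
  using (applyUpTo-∷ʳ; concatMap-cong; concatMap-map; length-applyUpTo; map-applyUpTo; map-concatMap;
         map-cong; map-tabulate; map-upTo)
open import Data.List.Relation.Unary.Any using (here; there)
open import Data.Nat.Base as ℕ using (ℕ; zero; suc; NonZero; z≤n; s≤s)
import Data.Nat.Properties as ℕ
open import Data.Product.Base using (∃-syntax; _×_; _,_; proj₁; proj₂)
open import Data.Sum.Base using (_⊎_; inj₁; inj₂)
open import Function.Base using (_∘_; id)
open import Function.Bundles using (_⇔_; mk⇔)
open import Relation.Binary.PropositionalEquality as ≡ using (_≡_; _≢_; cong; subst)
import Algebra.Apartness.Properties.HeytingCommutativeRing as HeytingProperties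
import Algebra.Properties.Ring as RingProperties
import Relation.Binary.Reasoning.Setoid as SetoidReasoning
import Algebra.Solver.Ring.NaturalCoefficients.Default as SemiringSolver

-- Intervals of natural numbers and their translates.

∈-range⁺ : ∀ {lo hi i} → lo ℕ.≤ i → i ℕ.≤ hi → i ∈ range lo hi
∈-range⁺ {lo} {hi} lo≤i i≤hi =
  subst (_∈ range lo hi) (ℕ.m+[n∸m]≡n lo≤i)
    (∈-applyUpTo⁺ (lo ℕ.+_) (ℕ.∸-monoˡ-< (s≤s i≤hi) lo≤i))

∈-range⁻ : ∀ {lo hi i} → i ∈ range lo hi → lo ℕ.≤ i × i ℕ.≤ hi
∈-range⁻ {lo} {hi} i∈ with j , j< , ≡.refl ← ∈-applyUpTo⁻ (lo ℕ.+_) i∈ =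
  ℕ.m≤m+n lo j ,
  ℕ.s≤s⁻¹ (ℕ.≰⇒> λ hi<lo+j → ℕ.<⇒≱ j< (ℕ.m≤n+o⇒m∸n≤o (suc hi) lo hi<lo+j))

-- Pointwise equal functions need not be propositionally equal, so both lists are written as `map`s
-- over `upTo n`, where `map-cong` asks for pointwise equality only.
applyUpTo-cong : ∀ {a} {A : Set a} {f g : ℕ → A} → (∀ i → f i ≡ g i) →
                 ∀ n → applyUpTo f n ≡ applyUpTo g n
applyUpTo-cong {f = f} {g} f≗g n = begin
  applyUpTo f n   ≡⟨ map-upTo f n ⟨
  map f (upTo n)  ≡⟨ map-cong f≗g (upTo n) ⟩
  map g (upTo n)  ≡⟨ map-upTo g n ⟩
  applyUpTo g n   ∎
  where open ≡.≡-Reasoning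

applyUpTo-+ : ∀ {a} {A : Set a} (f : ℕ → A) p q →
              applyUpTo f (p ℕ.+ q) ≡ applyUpTo f p ++ applyUpTo (f ∘ (p ℕ.+_)) q
applyUpTo-+ f zero    q = ≡.refl
applyUpTo-+ f (suc p) q = cong (f 0 ∷_) (applyUpTo-+ (f ∘ suc) p q)

range-+ : ∀ p lo hi → range (p ℕ.+ lo) (p ℕ.+ hi) ≡ map (p ℕ.+_) (range lo hi)
range-+ p lo hi = begin
  applyUpTo (p ℕ.+ lo ℕ.+_) (suc (p ℕ.+ hi) ℕ.∸ (p ℕ.+ lo))
    ≡⟨ cong (applyUpTo (p ℕ.+ lo ℕ.+_)) shift ⟩
  applyUpTo (p ℕ.+ lo ℕ.+_) (suc hi ℕ.∸ lo)
    ≡⟨ applyUpTo-cong (ℕ.+-assoc p lo) (suc hi ℕ.∸ lo) ⟩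
  applyUpTo (λ i → p ℕ.+ (lo ℕ.+ i)) (suc hi ℕ.∸ lo)
    ≡⟨ map-applyUpTo (lo ℕ.+_) (p ℕ.+_) (suc hi ℕ.∸ lo) ⟨
  map (p ℕ.+_) (range lo hi) ∎
  where
  open ≡.≡-Reasoning
  -- Truncated subtraction is invariant under translating both arguments, so the two intervals have
  -- the same length.
  shift : suc (p ℕ.+ hi) ℕ.∸ (p ℕ.+ lo) ≡ suc hi ℕ.∸ lo
  shift = ≡.trans (cong (ℕ._∸ (p ℕ.+ lo)) (≡.sym (ℕ.+-suc p hi)))
                  (ℕ.[m+n]∸[m+o]≡n∸o p (suc hi) lo)

-- Partial sums and the partition of the index set into blocks.

partialSum-suc : ∀ {n} (m : Fin (suc n) → ℕ) k →
                 partialSum m (suc k) ≡ partialSum m (inject₁ k) ℕ.+ m (suc k)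
partialSum-suc m zero    = ≡.refl
partialSum-suc m (suc k) =
  ≡.trans (cong (m zero ℕ.+_) (partialSum-suc (m ∘ suc) k))
          (≡.sym (ℕ.+-assoc (m zero) _ _))

partialSum≤total : ∀ {n} (m : Fin n → ℕ) k → partialSum m k ℕ.≤ total m
partialSum≤total m zero    = ℕ.m≤m+n (m zero) _
partialSum≤total m (suc k) = ℕ.+-monoʳ-≤ (m zero) (partialSum≤total (m ∘ suc) k)

-- `firstIndex` is defined through `inject₁`; this form recurses on the tail of `m` instead, as an
-- induction on `n` requires.
firstIndex-suc : ∀ {n} (m : Fin (suc n) → ℕ) k →
                 firstIndex m (suc k) ≡ m zero ℕ.+ firstIndex (m ∘ suc) k
firstIndex-suc m zero    = ≡.refl
firstIndex-suc m (suc k) = ℕ.+-assoc (m zero) _ 1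

1≤firstIndex : ∀ {n} (m : Fin n → ℕ) k → 1 ℕ.≤ firstIndex m k
1≤firstIndex m zero    = ℕ.≤-refl
1≤firstIndex m (suc k) = ℕ.m≤n+m 1 _

-- Kept in additive form so that the truncated subtraction in `range` can be evaluated by
-- cancellation.
firstIndex+m : ∀ {n} (m : Fin n → ℕ) k → firstIndex m k ℕ.+ m k ≡ suc (partialSum m k)
firstIndex+m m zero    = ≡.refl
firstIndex+m m (suc k) = begin
  partialSum m (inject₁ k) ℕ.+ 1 ℕ.+ m (suc k)   ≡⟨ ℕ.+-assoc (partialSum m (inject₁ k)) 1 _ ⟩
  partialSum m (inject₁ k) ℕ.+ suc (m (suc k))   ≡⟨ ℕ.+-suc (partialSum m (inject₁ k)) _ ⟩
  suc (partialSum m (inject₁ k) ℕ.+ m (suc k))   ≡⟨ cong suc (partialSum-suc m k) ⟨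
  suc (partialSum m (suc k))                     ∎
  where open ≡.≡-Reasoning

-- A positive multiplicity makes the block nonempty, so it has a last index, where the cycle closes.
firstIndex≤partialSum : ∀ {n} (m : Fin n → ℕ) k .{{_ : NonZero (m k)}} →
                        firstIndex m k ℕ.≤ partialSum m k
firstIndex≤partialSum m k = ℕ.s≤s⁻¹
  (subst (firstIndex m k ℕ.<_) (firstIndex+m m k) (ℕ.m<m+n (firstIndex m k) (ℕ.>-nonZero⁻¹ (m k))))

-- Unfolds to the same list as `Ĵ[ k ]`, but for an arbitrary vector `m`, so that an induction can
-- pass to its tail.
block : ∀ {n} → (Fin n → ℕ) → Fin n → List ℕ
block m k = range (firstIndex m k) (partialSum m k)

length-block : ∀ {n} (m : Fin n → ℕ) k → length (block m k) ≡ m k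
length-block m k = begin
  length (block m k)                              ≡⟨ length-applyUpTo (firstIndex m k ℕ.+_) _ ⟩
  suc (partialSum m k) ℕ.∸ firstIndex m k         ≡⟨ cong (ℕ._∸ firstIndex m k) (firstIndex+m m k) ⟨
  firstIndex m k ℕ.+ m k ℕ.∸ firstIndex m k       ≡⟨ ℕ.m+n∸m≡n (firstIndex m k) (m k) ⟩
  m k                                             ∎
  where open ≡.≡-Reasoning

-- Induction on `n`: after the first block is cut off, what remains is the interval of the tail
-- translated by `m zero`, and translation carries each block of the tail to the next block of `m`.
range-total : ∀ {n} (m : Fin n → ℕ) → range 1 (total m) ≡ concatMap (block m) (allFin n)
range-total {zero}  m = ≡.refl
range-total {suc n} m = begin
  applyUpTo suc (m zero ℕ.+ t)
    ≡⟨ applyUpTo-+ suc (m zero) t ⟩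
  block m zero ++ applyUpTo (λ i → suc (m zero ℕ.+ i)) t
    ≡⟨ cong (block m zero ++_) (applyUpTo-cong (λ i → ≡.sym (ℕ.+-suc (m zero) i)) t) ⟩
  block m zero ++ applyUpTo (λ i → m zero ℕ.+ suc i) t
    ≡⟨ cong (block m zero ++_) (map-applyUpTo suc (m zero ℕ.+_) t) ⟨
  block m zero ++ map (m zero ℕ.+_) (range 1 t)
    ≡⟨ cong (λ is → block m zero ++ map (m zero ℕ.+_) is) (range-total m′) ⟩
  block m zero ++ map (m zero ℕ.+_) (concatMap (block m′) (allFin n))
    ≡⟨ cong (block m zero ++_) (map-concatMap (m zero ℕ.+_) (block m′) (allFin n)) ⟩
  block m zero ++ concatMap (map (m zero ℕ.+_) ∘ block m′) (allFin n)
    ≡⟨ cong (block m zero ++_) (concatMap-cong block-suc (allFin n)) ⟨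
  block m zero ++ concatMap (block m ∘ suc) (allFin n)
    ≡⟨ cong (block m zero ++_) (concatMap-map (block m) suc (allFin n)) ⟨
  block m zero ++ concatMap (block m) (map suc (allFin n))
    ≡⟨ cong (λ ks → block m zero ++ concatMap (block m) ks) (map-tabulate id suc) ⟩
  concatMap (block m) (allFin (suc n)) ∎
  where
  open ≡.≡-Reasoning
  m′ = m ∘ suc
  t  = total m′
  block-suc : ∀ k → block m (suc k) ≡ map (m zero ℕ.+_) (block m′ k)
  block-suc k = ≡.trans (cong (λ lo → range lo (partialSum m (suc k))) (firstIndex-suc m k))
                        (range-+ (m zero) (firstIndex m′ k) (partialSum m′ k))

-- Order, squares and division in a constructive ordered field.

module RealFieldProperties {c ℓ₁ ℓ₂ ℓ₃} (ℝ : RealField c ℓ₁ ℓ₂ ℓ₃) where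
  open RealField ℝ
  open RingProperties ring using (-‿involutive; -‿distribˡ-*; -‿distribʳ-*; +-cancelˡ)
  open HeytingProperties heytingCommutativeRing using (x-0≈x)
  open CommutativeRing commutativeRing using (commutativeSemiring)
  open SemiringSolver commutativeSemiring using (solve; _:=_; _:+_; _:*_)
  open SetoidReasoning setoid

  -- The constructive substitute for trichotomy. Cotransitivity of apartness separates `z` from `x`
  -- or from `y`; if `z` lies on the outer side, transitivity puts it on the required side of the
  -- other point.
  <-cotrans : ∀ {x y} → x < y → ∀ z → x < z ⊎ z < y
  <-cotrans x<y z with #-cotrans (<⇒# x<y) z
  <-cotrans x<y z | inj₁ x#z with #⇒<⊎> x#z
  ... | inj₁ x<z = inj₁ x<z
  ... | inj₂ z<x = inj₂ (<.trans z<x x<y)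
  <-cotrans x<y z | inj₂ z#y with #⇒<⊎> z#y
  ... | inj₁ z<y = inj₂ z<y
  ... | inj₂ y<z = inj₁ (<.trans x<y y<z)

  ≤-reflexive : ∀ {x y} → x ≈ y → x ≤ y
  ≤-reflexive x≈y = <.irrefl (sym x≈y)

  ≤-refl : ∀ {x} → x ≤ x
  ≤-refl = ≤-reflexive refl

  -- As `≤` is a negation, a supposed `z < x` is refuted by locating `y` relative to it.
  ≤-trans : ∀ {x y z} → x ≤ y → y ≤ z → x ≤ z
  ≤-trans {y = y} x≤y y≤z z<x with <-cotrans z<x y
  ... | inj₁ z<y = y≤z z<y
  ... | inj₂ y<x = x≤y y<x

  <⇒≤ : ∀ {x y} → x < y → x ≤ y
  <⇒≤ x<y y<x = <.irrefl refl (<.trans x<y y<x)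

  ≤-respʳ-≈ : ∀ {x y z} → y ≈ z → x ≤ y → x ≤ z
  ≤-respʳ-≈ y≈z x≤y = ≤-trans x≤y (≤-reflexive y≈z)

  ≤-respˡ-≈ : ∀ {x y z} → x ≈ y → x ≤ z → y ≤ z
  ≤-respˡ-≈ x≈y x≤z = ≤-trans (≤-reflexive (sym x≈y)) x≤z

  x+y-y≈x : ∀ x y → x + y + - y ≈ x
  x+y-y≈x x y = trans (+-assoc x y (- y)) (trans (+-congˡ (-‿inverseʳ y)) (+-identityʳ x))

  +-cancelʳ-< : ∀ {x y} z → x + z < y + z → x < y
  +-cancelʳ-< {x} {y} z x+z<y+z =
    <.<-respˡ-≈ (x+y-y≈x x z) (<.<-respʳ-≈ (x+y-y≈x y z) (+-monoˡ-< (- z) x+z<y+z))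

  +-monoˡ-≤ : ∀ {x y} z → x ≤ y → x + z ≤ y + z
  +-monoˡ-≤ z x≤y y+z<x+z = x≤y (+-cancelʳ-< z y+z<x+z)

  +-mono-≤ : ∀ {x y u v} → x ≤ y → u ≤ v → x + u ≤ y + v
  +-mono-≤ {x} {y} {u} {v} x≤y u≤v =
    ≤-trans (+-monoˡ-≤ u x≤y)
      (≤-respˡ-≈ (+-comm u y) (≤-respʳ-≈ (+-comm v y) (+-monoˡ-≤ y u≤v)))

  x≤x+y : ∀ {x y} → 0# ≤ y → x ≤ x + y
  x≤x+y {x} 0≤y = ≤-respˡ-≈ (+-identityʳ x) (+-mono-≤ ≤-refl 0≤y)

  x+y≤x⇒y≤0 : ∀ {x y} → x + y ≤ x → y ≤ 0#
  x+y≤x⇒y≤0 {x} {y} x+y≤x 0<y =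
    x+y≤x (<.<-respˡ-≈ (+-identityˡ x) (<.<-respʳ-≈ (+-comm y x) (+-monoˡ-< x 0<y)))

  x<0⇒0<-x : ∀ {x} → x < 0# → 0# < - x
  x<0⇒0<-x {x} x<0 =
    <.<-respˡ-≈ (-‿inverseʳ x) (<.<-respʳ-≈ (+-identityˡ (- x)) (+-monoˡ-< (- x) x<0))

  0<-x⇒x<0 : ∀ {x} → 0# < - x → x < 0#
  0<-x⇒x<0 {x} 0<-x =
    <.<-respˡ-≈ (+-identityˡ x) (<.<-respʳ-≈ (-‿inverseˡ x) (+-monoˡ-< x 0<-x))

  pos*neg⇒neg : ∀ {x y} → 0# < x → y < 0# → x * y < 0#
  pos*neg⇒neg {x} {y} 0<x y<0 =
    0<-x⇒x<0 (<.<-respʳ-≈ (sym (-‿distribʳ-* x y)) (*-pos 0<x (x<0⇒0<-x y<0)))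

  #0⇒0<² : ∀ {x} → x # 0# → 0# < x ²
  #0⇒0<² {x} x#0 with #⇒<⊎> x#0
  ... | inj₂ 0<x = *-pos 0<x 0<x
  ... | inj₁ x<0 = <.<-respʳ-≈ -x²≈x² (*-pos (x<0⇒0<-x x<0) (x<0⇒0<-x x<0))
    where
    -x²≈x² : (- x) ² ≈ x ²
    -x²≈x² = begin
      - x * - x      ≈⟨ -‿distribˡ-* x (- x) ⟨
      - (x * - x)    ≈⟨ -‿cong (-‿distribʳ-* x x) ⟨
      - (- (x * x))  ≈⟨ -‿involutive (x * x) ⟩
      x * x          ∎

  -- Tightness reduces equality to the absence of apartness, and an `x` apart from zero would have a
  -- positive square.
  ²≤0⇒≈0 : ∀ {x} → x ² ≤ 0# → x ≈ 0#
  ²≤0⇒≈0 x²≤0 = proj₁ (tight _ _) λ x#0 → x²≤0 (#0⇒0<² x#0)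

  -- The sign of `x` cannot be decided. Instead, a negative square would force `x ≈ 0#`, hence a
  -- zero square, which is not negative.
  0≤² : ∀ x → 0# ≤ x ²
  0≤² x x²<0 = <.irrefl x²≈0 x²<0
    where
    x²≈0 : x ² ≈ 0#
    x²≈0 = trans (*-congʳ (²≤0⇒≈0 (<⇒≤ x²<0))) (zeroˡ x)

  0≤fromℕ : ∀ n → 0# ≤ fromℕ n
  0≤fromℕ zero    = ≤-refl
  0≤fromℕ (suc n) = <⇒≤ (0<fromℕ (suc n))

  fromℕ*[x/n]≈x : ∀ x n .{{_ : NonZero n}} → fromℕ n * (x / n) ≈ x
  fromℕ*[x/n]≈x x n = begin
    fromℕ n * (x * n⁻¹)     ≈⟨ rearrange (fromℕ n) x n⁻¹ ⟩
    -- Apartness yields an inverse of the difference `fromℕ n - 0#`, so the zero has to be inserted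
    -- first.
    x * (n⁻¹ * fromℕ n)     ≈⟨ *-congˡ (*-congˡ (x-0≈x (fromℕ n))) ⟨
    x * (n⁻¹ * (fromℕ n - 0#)) ≈⟨ *-congˡ (proj₁ (proj₂ inverse)) ⟩
    x * 1#                  ≈⟨ *-identityʳ x ⟩
    x                       ∎
    where
    inverse = #⇒invertible (#-sym (<⇒# (0<fromℕ n)))
    n⁻¹ = proj₁ inverse
    rearrange : ∀ p q r → p * (q * r) ≈ q * (r * p)
    rearrange = solve 3 (λ p q r → p :* (q :* r) := q :* (r :* p)) refl

  -- By contraposition: a negative quotient times the positive `fromℕ n` would make `x` negative.
  0≤x/n : ∀ {x} n .{{_ : NonZero n}} → 0# ≤ x → 0# ≤ x / n
  0≤x/n {x} n 0≤x x/n<0 =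
    0≤x (<.<-respˡ-≈ (fromℕ*[x/n]≈x x n) (pos*neg⇒neg (0<fromℕ n) x/n<0))

  -- Finite sums, the variance identity and telescoping.

  module _ {i} {I : Set i} where

    sum-cong : ∀ xs {f g : I → Carrier} → (∀ {j} → j ∈ xs → f j ≈ g j) →
               sumOver xs f ≈ sumOver xs g
    sum-cong []       f≈g = refl
    sum-cong (x ∷ xs) f≈g = +-cong (f≈g (here ≡.refl)) (sum-cong xs (f≈g ∘ there))

    sum-++ : ∀ xs ys (f : I → Carrier) → sumOver (xs ++ ys) f ≈ sumOver xs f + sumOver ys f
    sum-++ []       ys f = sym (+-identityˡ _)
    sum-++ (x ∷ xs) ys f = trans (+-congˡ (sum-++ xs ys f)) (sym (+-assoc (f x) _ _))

    sum-+ : ∀ xs (f g : I → Carrier) →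
            (∑[ j ∈ xs ] (f j + g j)) ≈ sumOver xs f + sumOver xs g
    sum-+ []       f g = sym (+-identityˡ 0#)
    sum-+ (x ∷ xs) f g = trans (+-congˡ (sum-+ xs f g)) (interchange (f x) (g x) _ _)
      where
      interchange : ∀ p q r s → (p + q) + (r + s) ≈ (p + r) + (q + s)
      interchange = solve 4 (λ p q r s → (p :+ q) :+ (r :+ s) := (p :+ r) :+ (q :+ s)) refl

    sum-*ˡ : ∀ xs x (f : I → Carrier) → (∑[ j ∈ xs ] (x * f j)) ≈ x * sumOver xs f
    sum-*ˡ []       x f = sym (zeroʳ x)
    sum-*ˡ (y ∷ xs) x f = trans (+-congˡ (sum-*ˡ xs x f)) (sym (distribˡ x (f y) _))

    sum-const : ∀ (xs : List I) x → (∑[ _ ∈ xs ] x) ≈ fromℕ (length xs) * x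
    sum-const []       x = sym (zeroˡ x)
    sum-const (_ ∷ xs) x = begin
      x + (∑[ _ ∈ xs ] x)              ≈⟨ +-cong (sym (*-identityˡ x)) (sum-const xs x) ⟩
      1# * x + fromℕ (length xs) * x   ≈⟨ distribʳ x 1# _ ⟨
      (1# + fromℕ (length xs)) * x     ∎

    sum-mono-≤ : ∀ xs {f g : I → Carrier} → (∀ j → f j ≤ g j) → sumOver xs f ≤ sumOver xs g
    sum-mono-≤ []       f≤g = ≤-refl
    sum-mono-≤ (x ∷ xs) f≤g = +-mono-≤ (f≤g x) (sum-mono-≤ xs f≤g)

    0≤sum : ∀ xs {f : I → Carrier} → (∀ j → 0# ≤ f j) → 0# ≤ sumOver xs f
    0≤sum []       0≤f = ≤-refl
    0≤sum (x ∷ xs) 0≤f = ≤-trans (0≤f x) (x≤x+y (0≤sum xs 0≤f))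

    term≤sum : ∀ {xs} {f : I → Carrier} → (∀ j → 0# ≤ f j) → ∀ {j} → j ∈ xs → f j ≤ sumOver xs f
    term≤sum {_ ∷ xs} 0≤f (here ≡.refl) = x≤x+y (0≤sum xs 0≤f)
    term≤sum {x ∷ _}  0≤f (there j∈xs)  =
      ≤-trans (term≤sum 0≤f j∈xs) (≤-respʳ-≈ (+-comm _ _) (x≤x+y (0≤f x)))

    -- The variance identity. The mean is characterised by having the same total as `f`, so no
    -- division enters.
    sum-² : ∀ xs (f : I → Carrier) μ → sumOver xs f ≈ (∑[ _ ∈ xs ] μ) →
            (∑[ j ∈ xs ] (f j ²)) ≈ (∑[ _ ∈ xs ] (μ ²)) + (∑[ j ∈ xs ] ((f j - μ) ²))
    sum-² xs f μ ∑f≈∑μ = begin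
      (∑[ j ∈ xs ] (f j ²))
        ≈⟨ sum-cong xs (λ {j} _ → trans (*-cong (split j) (split j)) (square μ (d j))) ⟩
      (∑[ j ∈ xs ] ((μ ² + d j ²) + (μ + μ) * d j))
        ≈⟨ sum-+ xs _ _ ⟩
      (∑[ j ∈ xs ] (μ ² + d j ²)) + (∑[ j ∈ xs ] ((μ + μ) * d j))
        ≈⟨ +-cong (sum-+ xs _ _) (sum-*ˡ xs (μ + μ) d) ⟩
      (∑[ _ ∈ xs ] (μ ²)) + (∑[ j ∈ xs ] (d j ²)) + (μ + μ) * sumOver xs d
        ≈⟨ +-congˡ (trans (*-congˡ ∑d≈0) (zeroʳ (μ + μ))) ⟩
      (∑[ _ ∈ xs ] (μ ²)) + (∑[ j ∈ xs ] (d j ²)) + 0#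
        ≈⟨ +-identityʳ _ ⟩
      (∑[ _ ∈ xs ] (μ ²)) + (∑[ j ∈ xs ] (d j ²)) ∎
      where
      d : I → Carrier
      d j = f j - μ
      split : ∀ j → f j ≈ μ + d j
      split j = sym (trans (+-comm μ (d j))
        (trans (+-assoc (f j) (- μ) μ) (trans (+-congˡ (-‿inverseˡ μ)) (+-identityʳ (f j)))))
      square : ∀ p q → (p + q) * (p + q) ≈ (p * p + q * q) + (p + p) * q
      square = solve 2 (λ p q → (p :+ q) :* (p :+ q) := (p :* p :+ q :* q) :+ (p :+ p) :* q) refl
      ∑d≈0 : sumOver xs d ≈ 0#
      -- Adding `∑ μ` turns the deviations back into `f`, whose total is again `∑ μ`.
      ∑d≈0 = +-cancelˡ (∑[ _ ∈ xs ] μ) _ _ (begin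
        (∑[ _ ∈ xs ] μ) + sumOver xs d  ≈⟨ sum-+ xs _ d ⟨
        (∑[ j ∈ xs ] (μ + d j))         ≈⟨ sum-cong xs (λ {j} _ → split j) ⟨
        sumOver xs f                    ≈⟨ ∑f≈∑μ ⟩
        (∑[ _ ∈ xs ] μ)                 ≈⟨ +-identityʳ _ ⟨
        (∑[ _ ∈ xs ] μ) + 0#            ∎)

  sum-concatMap : ∀ {i j} {I : Set i} {J : Set j} (xs : J → List I) ks (f : I → Carrier) →
                  sumOver (concatMap xs ks) f ≈ (∑[ k ∈ ks ] sumOver (xs k) f)
  sum-concatMap xs []       f = refl
  sum-concatMap xs (k ∷ ks) f =
    trans (sum-++ (xs k) (concatMap xs ks) f) (+-congˡ (sum-concatMap xs ks f))

  -- The index map `p` and the heights `h` are independent parameters so that the induction can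
  -- shift both by `suc`. The initial height stands on the left to keep subtraction out of the
  -- conclusion.
  telescope : ∀ {i} {I : Set i} (p : ℕ → I) (f : I → Carrier) (h : ℕ → Carrier) l →
              (∀ {j} → j ℕ.< l → f (p j) ≈ h (suc j) - h j) →
              sumOver (applyUpTo p l) f + h 0 ≈ h l
  telescope p f h zero    f≈ = +-identityˡ (h 0)
  telescope p f h (suc l) f≈ = begin
    f (p 0) + S + h 0           ≈⟨ +-congʳ (+-congʳ (f≈ (s≤s z≤n))) ⟩
    h 1 - h 0 + S + h 0         ≈⟨ rearrange (h 1) (- h 0) S (h 0) ⟩
    S + h 1 + (- h 0 + h 0)     ≈⟨ +-congˡ (-‿inverseˡ (h 0)) ⟩
    S + h 1 + 0#                ≈⟨ +-identityʳ _ ⟩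
    S + h 1                     ≈⟨ telescope (p ∘ suc) f (h ∘ suc) l (f≈ ∘ s≤s) ⟩
    h (suc l)                   ∎
    where
    S = sumOver (applyUpTo (p ∘ suc) l) f
    rearrange : ∀ a b s e → a + b + s + e ≈ s + a + (b + e)
    rearrange = solve 4 (λ a b s e → a :+ b :+ s :+ e := s :+ a :+ (b :+ e)) refl

  -- The differences before `hi` telescope to `θ hi - θ lo`, exactly what the closing distance
  -- `C - θ hi + θ lo` lacks to be `C`.
  cyclic-sum : ∀ {lo hi} → lo ℕ.≤ hi → ∀ (f θ : ℕ → Carrier) C →
               (∀ {i} → i ∈ range lo hi → i ≢ hi → f i ≈ θ (suc i) - θ i) →
               f hi ≈ C - θ hi + θ lo →
               sumOver (range lo hi) f ≈ C
  cyclic-sum {lo} lo≤hi f θ C step last with l , ≡.refl ← ℕ.m≤n⇒∃[o]m+o≡n lo≤hi = begin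
    sumOver (range lo hi) f
      ≡⟨ cong (λ is → sumOver is f) range≡ ⟩
    sumOver (applyUpTo (lo ℕ.+_) l ++ hi ∷ []) f
      ≈⟨ sum-++ (applyUpTo (lo ℕ.+_) l) (hi ∷ []) f ⟩
    S + (f hi + 0#)
      ≈⟨ +-congˡ (trans (+-identityʳ (f hi)) last) ⟩
    S + (C - θ hi + θ lo)
      ≈⟨ rearrange S C (- θ hi) (θ lo) ⟩
    C + (- θ hi + (S + θ lo))
      ≈⟨ +-congˡ (+-congˡ S+θlo≈θhi) ⟩
    C + (- θ hi + θ hi)
      ≈⟨ trans (+-congˡ (-‿inverseˡ (θ hi))) (+-identityʳ C) ⟩
    C ∎
    where
    hi = lo ℕ.+ l
    S  = sumOver (applyUpTo (lo ℕ.+_) l) f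
    range≡ : range lo hi ≡ applyUpTo (lo ℕ.+_) l ++ hi ∷ []
    range≡ = ≡.trans
      (cong (applyUpTo (lo ℕ.+_))
        (≡.trans (cong (ℕ._∸ lo) (≡.sym (ℕ.+-suc lo l))) (ℕ.m+n∸m≡n lo (suc l))))
      (≡.sym (applyUpTo-∷ʳ (lo ℕ.+_) l))
    rearrange : ∀ s a b e → s + (a + b + e) ≈ a + (b + (s + e))
    rearrange = solve 4 (λ s a b e → s :+ (a :+ b :+ e) := a :+ (b :+ (s :+ e))) refl
    interior : ∀ {j} → j ℕ.< l → f (lo ℕ.+ j) ≈ θ (lo ℕ.+ suc j) - θ (lo ℕ.+ j)
    interior {j} j<l = subst (λ i → f (lo ℕ.+ j) ≈ θ i - θ (lo ℕ.+ j)) (≡.sym (ℕ.+-suc lo j))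
      (step (∈-range⁺ (ℕ.m≤m+n lo j) (ℕ.<⇒≤ lo+j<hi)) (ℕ.<⇒≢ lo+j<hi))
      where
      lo+j<hi : lo ℕ.+ j ℕ.< lo ℕ.+ l
      lo+j<hi = ℕ.+-monoʳ-< lo j<l
    S+θlo≈θhi : S + θ lo ≈ θ hi
    -- Telescoping starts at height `θ (lo + 0)`, which does not reduce to `θ lo`.
    S+θlo≈θhi = trans (+-congˡ (reflexive (cong θ (≡.sym (ℕ.+-identityʳ lo)))))
      (telescope (lo ℕ.+_) f (θ ∘ (lo ℕ.+_)) l interior)

-- The lower bound for the program and the minimisers of the block problems.

module Bounds {c ℓ₁ ℓ₂ ℓ₃ a} (ℝ : RealField c ℓ₁ ℓ₂ ℓ₃) (P : CyclicSequencingProblem a) where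
  open RealField ℝ
  open CyclicSequencingProblem P
  open MIQP ℝ P
  open RealFieldProperties ℝ
  open RingProperties ring using (x∙y⁻¹≈ε⇒x≈y)
  open SetoidReasoning setoid

  Ĵ[]⊆Ĵ : ∀ k {i} → i ∈ Ĵ[ k ] → i ∈ Ĵ
  Ĵ[]⊆Ĵ k i∈Ĵₖ with lo≤i , i≤hi ← ∈-range⁻ i∈Ĵₖ =
    ∈-range⁺ (ℕ.≤-trans (1≤firstIndex m k) lo≤i) (ℕ.≤-trans i≤hi (partialSum≤total m k))

  feasible⇒feasibleFor : ∀ {s} → Feasible s → ∀ k → FeasibleFor k (Assignment.Δ s)
  feasible⇒feasibleFor {s} feasible k =
    cyclic-sum (firstIndex≤partialSum m k) Δ θ (fromℕ N) (distance k) (wraparound k) ,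
    Δ-nonNeg ∘ Ĵ[]⊆Ĵ k
    where
    open Assignment s
    open Feasible feasible

  cost≈∑costFor : ∀ s → cost s ≈ (∑[ k ∈ allFin n ] costFor k (Assignment.Δ s))
  cost≈∑costFor s = trans
    (reflexive (cong (λ is → sumOver is Δ²) (range-total m)))
    (sum-concatMap Ĵ[_] (allFin n) Δ²)
    where
    Δ² : ℕ → Carrier
    Δ² i = Assignment.Δ s i ²

  -- On each block the distances of a feasible solution compete in the problem whose minimum is
  -- `LB k`; these inequalities are then added.
  LB-valid : ∀ (LB : Fin n → Carrier) → (∀ k → IsLB k (LB k)) →
             IsValidLowerBound (∑[ k ∈ allFin n ] LB k)
  LB-valid LB isLB s feasible =
    ≤-respʳ-≈ (sym (cost≈∑costFor s)) (sum-mono-≤ (allFin n) λ k → LB≤costFor k (isLB k))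
    where
    LB≤costFor : ∀ k → IsLB k (LB k) → LB k ≤ costFor k (Assignment.Δ s)
    LB≤costFor k (_ , (_ , minimal) , cost≈LB) =
      ≤-respˡ-≈ cost≈LB (minimal _ (feasible⇒feasibleFor feasible k))

  module _ (k : Fin n) where

    mean : Carrier
    mean = fromℕ N / m k

    ∑mean≈N : (∑[ _ ∈ Ĵ[ k ] ] mean) ≈ fromℕ N
    ∑mean≈N = begin
      (∑[ _ ∈ Ĵ[ k ] ] mean)         ≈⟨ sum-const Ĵ[ k ] mean ⟩
      fromℕ (length Ĵ[ k ]) * mean   ≡⟨ cong (λ l → fromℕ l * mean) (length-block m k) ⟩
      fromℕ (m k) * mean             ≈⟨ fromℕ*[x/n]≈x (fromℕ N) (m k) ⟩
      fromℕ N                        ∎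

    costFor-split : ∀ {Δ} → FeasibleFor k Δ →
      costFor k Δ ≈ costFor k (λ _ → mean) + (∑[ i ∈ Ĵ[ k ] ] ((Δ i - mean) ²))
    costFor-split {Δ} (∑Δ≈N , _) = sum-² Ĵ[ k ] Δ mean (trans ∑Δ≈N (sym ∑mean≈N))

    -- Agreement is asked on the block only, since values of `Δ` elsewhere enter neither the
    -- constraints nor the cost.
    ≈mean⇒optimal : ∀ Δ → (∀ {i} → i ∈ Ĵ[ k ] → Δ i ≈ mean) → IsOptimalFor k Δ
    ≈mean⇒optimal Δ Δ≈mean =
      (trans (sum-cong Ĵ[ k ] Δ≈mean) ∑mean≈N ,
       λ i∈ → ≤-respʳ-≈ (sym (Δ≈mean i∈)) (0≤x/n (m k) (0≤fromℕ N))) ,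
      λ Δ′ feasible →
        ≤-respˡ-≈ (sum-cong Ĵ[ k ] (λ i∈ → sym (*-cong (Δ≈mean i∈) (Δ≈mean i∈))))
          (≤-respʳ-≈ (sym (costFor-split feasible))
            (x≤x+y (0≤sum Ĵ[ k ] (λ i → 0≤² (Δ′ i - mean)))))

    mean-optimal : IsOptimalFor k (λ _ → mean)
    mean-optimal = ≈mean⇒optimal _ (λ _ → refl)

    optimal⇒≈mean : ∀ Δ → IsOptimalFor k Δ → ∀ {i} → i ∈ Ĵ[ k ] → Δ i ≈ mean
    optimal⇒≈mean Δ (feasible , minimal) {i} i∈ =
      x∙y⁻¹≈ε⇒x≈y (Δ i) mean (²≤0⇒≈0 (≤-trans
        -- All squared deviations are nonnegative, so each is at most their sum, which comparison
        -- with the constant family bounds by zero.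
        (term≤sum (λ j → 0≤² (Δ j - mean)) i∈)
        (x+y≤x⇒y≤0 (≤-respˡ-≈ (costFor-split feasible) (minimal _ (proj₁ mean-optimal))))))

lemma5 : ∀ {c ℓ₁ ℓ₂ ℓ₃ a : Level}
    (ℝ : RealField c ℓ₁ ℓ₂ ℓ₃) (P : CyclicSequencingProblem a) →
    let open RealField ℝ
        open CyclicSequencingProblem P
        open MIQP ℝ P
    in
    (∀ (k : Fin n) → ∃[ v ] IsLB k v) ×
    (∀ (LB : Fin n → Carrier) → (∀ k → IsLB k (LB k)) →
      IsValidLowerBound (∑[ k ∈ allFin n ] LB k)) ×
    (∀ (k : Fin n) (Δ : ℕ → Carrier) →
      IsOptimalFor k Δ ⇔ (∀ {i} → i ∈ Ĵ[ k ] → Δ i ≈ fromℕ N / m k))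
lemma5 ℝ P =
  -- The minimum is the cost of the constant family; unification supplies both the value and the
  -- minimiser.
  (λ k → _ , _ , mean-optimal k , refl) ,
  LB-valid ,
  λ k Δ → mk⇔ (optimal⇒≈mean k Δ) (≈mean⇒optimal k Δ)
  where
  open RealField ℝ using (refl)
  open Bounds ℝ P
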